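{- Every ab-ba rotor type $r$ whose period consists of more than one block $12$ and exactly one block $21$ is universal.
   Context: A rotor type is an infinite periodic sequence $r=(r^{(1)},r^{(2)},\dots)$ of natural numbers (states), with fundamental period $|r|$; two rotor types are equivalent if one is obtained from the other by an injective relabeling of states. A two-state rotor type is written over $\{1,2\}$ with $r^{(1)}=1$; it is ab-ba if $|r|$ is even and for every $k\ge 0$ the pair $(r^{(2k+1)},r^{(2k+2)})$ (called the $(k+1)$-th block) is $12$ or $21$. A rotor-router network consists of a finite digraph (loops and multiple edges allowed), a source vertex, a set of target vertices of outdegree $0$ such that every non-target vertex can reach a target, and at each non-target vertex $v$ a periodic sequence $e_v^{(1)},e_v^{(2)},\dots$ of out-edges; a particle starts at the source, on its $n$-th visit to a non-target vertex $v$ leaves along $e_v^{(n)}$, and whenever it reaches a target it is returned to the source. The hitting sequence is the (periodic) sequence of targets reached. A network is homogeneous of type $r$ if at every non-target vertex $v$, $e_v^{(n)}=\phi_v(r^{(n)})$ for some injective map $\phi_v$ from states of $r$ to out-edges of $v$. A rotor type $r$ models $r'$ if some homogeneous network of type $r$ has hitting sequence (targets regarded as states) equivalent to $r'$; $r$ is universal if it models every rotor type. -}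

module Defs where

open import Data.Nat using (ℕ; zero; suc; _+_; _*_; _<_; _≤_)
open import Data.Nat.Properties using ()
open import Data.Fin using (Fin; _≟_)
open import Data.Bool using (Bool; true; false; if_then_else_)
open import Data.List using (List; []; [_]; _++_; head; drop)
open import Data.Maybe using (Maybe; just; nothing; maybe)
open import Data.Product using (Σ; ∃; ∃-syntax; _×_; _,_; proj₁; proj₂)
open import Data.Sum using (_⊎_)
open import Relation.Nullary using (¬_)
open import Relation.Nullary.Decidable using (⌊_⌋)
open import Relation.Binary.PropositionalEquality using (_≡_)

-- Rotor types.  Sequences are 0-indexed: r n stands for r^{(n+1)}.

Periodic : (ℕ → ℕ) → ℕ → Set
Periodic r p = ∀ n → r (p + n) ≡ r n

IsRotorType : (ℕ → ℕ) → Set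
IsRotorType r = ∃[ p ] (0 < p × Periodic r p)

FundamentalPeriod : (ℕ → ℕ) → ℕ → Set
FundamentalPeriod r p = 0 < p × Periodic r p × (∀ q → 0 < q → Periodic r q → p ≤ q)

TwoState : (ℕ → ℕ) → Set
TwoState r = r 0 ≡ 1 × (∀ n → r n ≡ 1 ⊎ r n ≡ 2)

Block12 : (ℕ → ℕ) → ℕ → Set
Block12 r k = r (2 * k) ≡ 1 × r (suc (2 * k)) ≡ 2

Block21 : (ℕ → ℕ) → ℕ → Set
Block21 r k = r (2 * k) ≡ 2 × r (suc (2 * k)) ≡ 1

Even : ℕ → Set
Even n = ∃[ m ] n ≡ 2 * m

IsAbBa : (ℕ → ℕ) → Set
IsAbBa r = IsRotorType r × TwoState r
         × (∃[ p ] (FundamentalPeriod r p × Even p))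
         × (∀ k → Block12 r k ⊎ Block21 r k)

data Reaches {V E : ℕ} (src tgt : Fin E → Fin V) (isT : Fin V → Bool) : Fin V → Set where
  here  : ∀ {v} → isT v ≡ true → Reaches src tgt isT v
  there : ∀ e → Reaches src tgt isT (tgt e) → Reaches src tgt isT (src e)

record Network : Set where
  field
    V E      : ℕ
    src tgt  : Fin E → Fin V            -- multigraph: loops / multi-edges allowed
    source   : Fin V
    isTarget : Fin V → Bool
    rotor    : Fin V → ℕ → Fin E        -- rotor v n = e_v^{(n+1)}
    source-nonTarget : isTarget source ≡ false
    target-outdeg0   : ∀ e → isTarget (src e) ≡ false
    reach            : ∀ v → isTarget v ≡ false → Reaches src tgt isTarget v
    rotor-out        : ∀ v → isTarget v ≡ false → ∀ n → src (rotor v n) ≡ v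
    rotor-periodic   : ∀ v → isTarget v ≡ false →
                         ∃[ p ] (0 < p × (∀ n → rotor v (p + n) ≡ rotor v n))

module Run (N : Network) where
  open Network N

  -- current vertex and number of previous visits of each vertex
  Config : Set
  Config = Fin V × (Fin V → ℕ)

  step : Config → Config × Maybe (Fin V)
  step (v , c) =
    let e  = rotor v (c v)
        w  = tgt e
        c′ = λ u → if ⌊ u ≟ v ⌋ then suc (c u) else c u
    in if isTarget w then ((source , c′) , just w) else ((w , c′) , nothing)

  config : ℕ → Config
  config zero    = (source , λ _ → 0)
  config (suc n) = proj₁ (step (config n))

  hitsUpTo : ℕ → List (Fin V)
  hitsUpTo zero    = []
  hitsUpTo (suc n) = hitsUpTo n ++ maybe [_] [] (proj₂ (step (config n)))

  KthHit : ℕ → Fin V → Set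
  KthHit k t = ∃[ n ] (head (drop k (hitsUpTo n)) ≡ just t)

Homogeneous : Network → (ℕ → ℕ) → Set
Homogeneous N r =
  Σ (Fin V → ℕ → Fin E) λ φ → ∀ v → isTarget v ≡ false →
      (∀ m n → φ v (r m) ≡ φ v (r n) → r m ≡ r n)
    × (∀ n → rotor v n ≡ φ v (r n))
  where open Network N

HittingEquiv : Network → (ℕ → ℕ) → Set
HittingEquiv N r′ =
  Σ (Fin V → ℕ) λ ψ → (∀ a b → ψ a ≡ ψ b → a ≡ b)
    × (∀ k → ∃[ t ] (KthHit k t × ψ t ≡ r′ k))
  where open Network N
        open Run N

Models : (ℕ → ℕ) → (ℕ → ℕ) → Set
Models r r′ = Σ Network λ N → Homogeneous N r × HittingEquiv N r′

Universal : (ℕ → ℕ) → Set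
Universal r = ∀ r′ → IsRotorType r′ → Models r r′

-- The network is a binary tree of rotors whose leaves are targets or lead back to the root, so
-- its hitting sequence is the sequence of leaves with the back leaves deleted.  Give the root
-- two identical subtrees.  In each block of the root both are visited once and behave alike; a
-- path in them that always leads back when the block is 21 makes the successes alternate
-- strictly, as for the rotor type 12.  Iterating gives a tree cycling through 2 ^ d leaves, and
-- deleting all but p of them gives every sequence of period p.
--
-- For the path, follow a residue class c of visit times modulo m.  If r does not separate c from
-- c + m, the other state is never seen at these times.  Otherwise each child sees a single
-- residue class again, and ⌊ c /2⌋ is one of them.  As t has the descendants t, 2t, 2t + 1,
-- 4t, ... under inverse halving, which fill long intervals, one class that r does not separate
-- settles all classes.
module Submission where

open import Defs
open import Data.Bool using (Bool; true; false; not; _∧_; if_then_else_; _≟_)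
open import Data.Bool.Properties using (∧-zeroʳ; ∧-identityʳ; ¬-not; not-¬)
open import Data.Fin using (Fin; zero; suc; toℕ; fromℕ<; _↑ˡ_; _↑ʳ_; splitAt; combine; remQuot)
import Data.Fin as Fin
open import Data.Fin.Properties using (toℕ-injective; toℕ-↑ˡ; toℕ-fromℕ<; splitAt-↑ˡ; splitAt-↑ʳ; splitAt⁻¹-↑ˡ; splitAt⁻¹-↑ʳ; ↑ʳ-injective; remQuot-combine; combine-injectiveʳ; 2↔Bool)
open import Data.List using (List; []; _∷_; [_]; length; _++_; head; drop)
open import Data.List.Properties using (++-identityʳ; length-++)
open import Data.Maybe using (Maybe; just; nothing; maybe; is-just; map)
open import Data.Nat using (ℕ; zero; suc; pred; _+_; _*_; _∸_; _^_; _⊔_; _≤_; _<_; _<?_; z≤n; s≤s; ⌊_/2⌋; NonZero; >-nonZero)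
import Data.Nat as ℕ
open import Data.Nat.DivMod
open import Data.Nat.Properties hiding (_≟_; _<?_)
open import Data.Nat.Tactic.RingSolver using (solve-∀)
open import Data.Product using (∃-syntax; _×_; _,_; proj₁; proj₂)
open import Data.Sum using (_⊎_; inj₁; inj₂; [_,_]′)
open import Function using (_∘_; id; const; Inverse)
open import Relation.Binary.PropositionalEquality hiding ([_])
open import Relation.Nullary using (does; yes; no; contradiction)
open import Relation.Nullary.Decidable using (⌊_⌋; dec-true; dec-false)

-- Selections of times and their composition.

count : (ℕ → Bool) → ℕ → ℕ
count P zero    = 0
count P (suc n) = if P n then suc (count P n) else count P n

count-suc-true : ∀ P {n} → P n ≡ true → count P (suc n) ≡ suc (count P n)
count-suc-true P p rewrite p = refl

count-suc-false : ∀ P {n} → P n ≡ false → count P (suc n) ≡ count P n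
count-suc-false P p rewrite p = refl

count-cong : ∀ {P Q} → (∀ n → P n ≡ Q n) → ∀ n → count P n ≡ count Q n
count-cong     eq zero    = refl
count-cong {Q = Q} eq (suc n) rewrite eq n | count-cong eq n = refl

count-const-true : ∀ n → count (λ _ → true) n ≡ n
count-const-true zero    = refl
count-const-true (suc n) = cong suc (count-const-true n)

-- Infinitely many successes, given by rank because the hit with a prescribed number has to be
-- located later.
Unbounded : (ℕ → Bool) → Set
Unbounded P = ∀ k → ∃[ n ] (P n ≡ true × count P n ≡ k)

infixr 6 _▷_

-- `Q` is read on the clock of a child, which ticks only when `P` holds at the parent.
_▷_ : (ℕ → Bool) → (ℕ → Bool) → ℕ → Bool
(P ▷ Q) n = P n ∧ Q (count P n)

count-▷ : ∀ P Q n → count (P ▷ Q) n ≡ count Q (count P n)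
count-▷ P Q zero    = refl
count-▷ P Q (suc n) rewrite count-▷ P Q n with P n
... | true  = refl
... | false = refl

▷-unbounded : ∀ P Q → Unbounded P → Unbounded Q → Unbounded (P ▷ Q)
▷-unbounded P Q uP uQ k with uQ k
... | i , Qi , ci with uP i
... | n , Pn , cn =
  n , trans (cong₂ (λ x y → x ∧ Q y) Pn cn) Qi , trans (count-▷ P Q n) (trans (cong (count Q) cn) ci)

-- Doubling, halving and parity.

double : ℕ → ℕ
double zero    = zero
double (suc n) = suc (suc (double n))

double≡2* : ∀ n → double n ≡ 2 * n
double≡2* zero    = refl
double≡2* (suc n) = cong suc (trans (cong suc (double≡2* n)) (sym (+-suc n (n + 0))))

double-+ : ∀ m n → double (m + n) ≡ double m + double n
double-+ zero    n = refl
double-+ (suc m) n = cong (λ x → suc (suc x)) (double-+ m n)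

⌊double/2⌋ : ∀ n → ⌊ double n /2⌋ ≡ n
⌊double/2⌋ zero    = refl
⌊double/2⌋ (suc n) = cong suc (⌊double/2⌋ n)

⌊suc-double/2⌋ : ∀ n → ⌊ suc (double n) /2⌋ ≡ n
⌊suc-double/2⌋ zero    = refl
⌊suc-double/2⌋ (suc n) = cong suc (⌊suc-double/2⌋ n)

data Parity : ℕ → Set where
  even : ∀ k → Parity (double k)
  odd  : ∀ k → Parity (suc (double k))

parity : ∀ n → Parity n
parity zero    = even 0
parity (suc n) with parity n
... | even k = odd k
... | odd k  = even (suc k)

n≤double : ∀ n → n ≤ double n
n≤double n = subst (n ≤_) (sym (double≡2* n)) (m≤m+n n _)

-- `true` takes the even numbers because state 1, read as `true`, comes first in a block 12.
branch : Bool → ℕ → ℕ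
branch true  = double
branch false = suc ∘ double

count-halved : ∀ P k → count (P ∘ ⌊_/2⌋) (double k) ≡ double (count P k)
count-halved P zero    = refl
count-halved P (suc k)
  rewrite ⌊double/2⌋ k | ⌊suc-double/2⌋ k | count-halved P k with P k
... | true  = refl
... | false = refl

count-halved-odd : ∀ P k → P k ≡ true →
  count (P ∘ ⌊_/2⌋) (suc (double k)) ≡ suc (double (count P k))
count-halved-odd P k Pk rewrite ⌊double/2⌋ k | Pk = cong suc (count-halved P k)

halved-unbounded : ∀ P → Unbounded P → Unbounded (P ∘ ⌊_/2⌋)
halved-unbounded P u k with parity k
... | even i with u i
...   | n , Pn , refl = double n , trans (cong P (⌊double/2⌋ n)) Pn , count-halved P n
halved-unbounded P u k | odd i with u i
...   | n , Pn , refl = suc (double n) , trans (cong P (⌊suc-double/2⌋ n)) Pn , count-halved-odd P n Pn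

n<2^n : ∀ n → n < 2 ^ n
n<2^n zero    = s≤s z≤n
n<2^n (suc n) = ≤-trans (+-mono-≤ (m^n>0 2 n) (n<2^n n))
                        (≤-reflexive (cong (2 ^ n +_) (sym (+-identityʳ (2 ^ n)))))

-- A leaf nothing sends the particle back to the root.
data Tree (O : Set) : Set where
  leaf : Maybe O → Tree O
  node : (Bool → Tree O) → Tree O

-- Trees of rotors and their leaf sequences.

module Traversal (b : ℕ → Bool) where

  at : Bool → ℕ → Bool
  at s n = does (b n ≟ s)

  at-self : ∀ n → at (b n) n ≡ true
  at-self n = dec-true (b n ≟ b n) refl

  -- The leaf reached by the (n+1)-st traversal when each node follows b.
  leafAt : ∀ {O} → Tree O → ℕ → Maybe O
  leafAt (leaf o)  n = o
  leafAt (node ts) n = leafAt (ts (b n)) (count (at (b n)) n)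

  -- Every wrong turn leads back to the root, so a chain thins out the visits to `t` and adds no
  -- hits.
  chain : ∀ {O} → List Bool → Tree O → Tree O
  chain []       t = t
  chain (s ∷ ss) t = node λ s′ → if does (s′ ≟ s) then chain ss t else leaf nothing

  pass : List Bool → ℕ → Bool
  pass []       = λ _ → true
  pass (s ∷ ss) = at s ▷ pass ss

  leafAt-chain : ∀ {O} ss (t : Tree O) n →
    leafAt (chain ss t) n ≡ (if pass ss n then leafAt t (count (pass ss) n) else nothing)
  leafAt-chain []       t n = cong (leafAt t) (sym (count-const-true n))
  leafAt-chain (s ∷ ss) t n with b n ≟ s
  ... | no  _    = refl
  ... | yes refl rewrite leafAt-chain ss t (count (at (b n)) n) | count-▷ (at (b n)) (pass ss) n = refl

  -- The leaves read g 0, …, g (2 ^ d - 1) from the outermost branching to the innermost,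
  -- least significant bit first.
  counter : ∀ {O} → List Bool → ℕ → (ℕ → Maybe O) → Tree O
  counter ss zero    g = leaf (g 0)
  counter ss (suc d) g = node λ s → chain ss (counter ss d (g ∘ branch s))

  -- In an ab-ba tree both children run on the clock `⌊ n /2⌋` (`count-at-self`), so getting through
  -- to a leaf does not depend on the side taken.
  live : List Bool → ℕ → ℕ → Bool
  live ss zero    n = true
  live ss (suc d) n = (pass ss ▷ live ss d) ⌊ n /2⌋

  live-unbounded : ∀ ss → Unbounded (pass ss) → ∀ d → Unbounded (live ss d)
  live-unbounded ss u zero    k = k , refl , count-const-true k
  live-unbounded ss u (suc d) =
    halved-unbounded (pass ss ▷ live ss d) (▷-unbounded (pass ss) (live ss d) u (live-unbounded ss u d))

  module AbBa (alternating : ∀ k → b (suc (double k)) ≡ not (b (double k))) where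

    -- Each block contains either state once.
    count-at-double : ∀ s k → count (at s) (double k) ≡ k
    count-at-double s zero    = refl
    count-at-double s (suc k) rewrite alternating k | count-at-double s k with b (double k) | s
    ... | true  | true  = refl
    ... | true  | false = refl
    ... | false | true  = refl
    ... | false | false = refl

    count-at-odd : ∀ k → count (at (b (suc (double k)))) (suc (double k)) ≡ k
    count-at-odd k rewrite alternating k | count-at-double (not (b (double k))) k with b (double k)
    ... | true  = refl
    ... | false = refl

    -- The local time of the chosen child is the number of the current block, for both visits of the
    -- block. Hence identical subtrees behave alike in it.
    count-at-self : ∀ n → count (at (b n)) n ≡ ⌊ n /2⌋
    count-at-self n with parity n
    ... | even k = trans (count-at-double (b (double k)) k) (sym (⌊double/2⌋ k))
    ... | odd k  = trans (count-at-odd k) (sym (⌊suc-double/2⌋ k))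

    at-unbounded : ∀ s → Unbounded (at s)
    at-unbounded s k with b (double k) ≟ s
    ... | yes refl = double k , at-self (double k) , count-at-double (b (double k)) k
    ... | no  ¬eq  = suc (double k) , dec-true (b (suc (double k)) ≟ s) eq ,
                     subst (λ x → count (at x) (suc (double k)) ≡ k) eq (count-at-odd k)
      where
      eq : b (suc (double k)) ≡ s
      eq = trans (alternating k) (sym (¬-not (¬eq ∘ sym)))

    -- Both subtrees of the root are passed or blocked together; the swapped blocks are
    -- blocked, so a successful pair visits the true branch first.
    leafAt-counter : ∀ {O} ss → (∀ k → pass ss k ≡ true → b (double k) ≡ true) →
      ∀ d (g : ℕ → Maybe O) → (∀ i → g (2 ^ d + i) ≡ g i) →
      ∀ n → leafAt (counter ss d g) n ≡ (if live ss d n then g (count (live ss d) n) else nothing)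
    leafAt-counter ss ordered zero g periodic n =
      -- Here `2 ^ d` is 1, so `g` is constant.
      trans (constant n) (cong g (sym (count-const-true n)))
      where
      constant : ∀ n → g 0 ≡ g n
      constant zero    = refl
      constant (suc n) = trans (constant n) (sym (periodic n))
    leafAt-counter ss ordered (suc d) g periodic n =
      trans (cong (leafAt (chain ss _)) (count-at-self n))
      (trans (leafAt-chain ss _ ⌊ n /2⌋)
      (trans (cong (λ x → if P ⌊ n /2⌋ then x else nothing)
                   (leafAt-counter ss ordered d (g ∘ branch (b n)) (periodic′ (b n)) _))
      (merge n)))
      where
      P Q PQ : ℕ → Bool
      P  = pass ss
      Q  = live ss d
      PQ = P ▷ Q
      doubled : ∀ i → double (2 ^ d + i) ≡ 2 ^ suc d + double i
      doubled i = trans (double-+ (2 ^ d) i) (cong (_+ double i) (double≡2* (2 ^ d)))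
      periodic′ : ∀ s i → g (branch s (2 ^ d + i)) ≡ g (branch s i)
      periodic′ true  i = trans (cong g (doubled i)) (periodic (double i))
      periodic′ false i = trans (cong g (trans (cong suc (doubled i)) (sym (+-suc (2 ^ suc d) (double i)))))
                                (periodic (suc (double i)))
      select : ∀ k n → P k ≡ true → Q (count P k) ≡ true →
        branch (b n) (count PQ k) ≡ count (PQ ∘ ⌊_/2⌋) n →
        g (branch (b n) (count Q (count P k))) ≡ g (count (PQ ∘ ⌊_/2⌋) n)
      select k n p q eq = cong g (trans (cong (branch (b n)) (sym (count-▷ P Q k))) eq)
      rank : ∀ n → PQ ⌊ n /2⌋ ≡ true → P ⌊ n /2⌋ ≡ true →
        branch (b n) (count PQ ⌊ n /2⌋) ≡ count (PQ ∘ ⌊_/2⌋) n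
      rank n pq p with parity n
      -- A passing block is ordered: its even time reads `true` and its odd time `false`, which
      -- matches the even and odd ranks of the two successes.
      ... | even k rewrite ⌊double/2⌋ k | ordered k p = sym (count-halved PQ k)
      ... | odd k rewrite ⌊suc-double/2⌋ k | alternating k | ordered k p = sym (count-halved-odd PQ k pq)
      merge : ∀ n →
        (if P ⌊ n /2⌋ then (if Q (count P ⌊ n /2⌋)
           then g (branch (b n) (count Q (count P ⌊ n /2⌋))) else nothing) else nothing)
        ≡ (if PQ ⌊ n /2⌋ then g (count (PQ ∘ ⌊_/2⌋) n) else nothing)
      merge n with P ⌊ n /2⌋ in p | Q (count P ⌊ n /2⌋) in q
      ... | false | _     = refl
      ... | true  | false = refl
      ... | true  | true  = select ⌊ n /2⌋ n p q (rank n (cong₂ _∧_ p q) p)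

-- Paths that block a residue class of times.

module Avoidance (b : ℕ → Bool)
  (alternating : ∀ k → b (suc (double k)) ≡ not (b (double k)))
  (m : ℕ) (periodic : ∀ n → b (n + double m) ≡ b n) where

  open Traversal b
  open AbBa alternating

  periodic-* : ∀ x n → b (n + double (x * m)) ≡ b n
  periodic-* zero    n = cong b (+-identityʳ n)
  periodic-* (suc x) n =
    trans (cong b (trans (cong (n +_) (double-+ m (x * m)))
                  (trans (cong (n +_) (+-comm (double m) _)) (sym (+-assoc n _ _)))))
          (trans (periodic (n + double (x * m))) (periodic-* x n))

  -- The shift is a whole number of periods, in which both states occur equally often, so the clock
  -- of a child advances by half of it.
  count-shift : ∀ s x n → count (at s) (n + double (x * m)) ≡ count (at s) n + x * m
  count-shift s x zero    = count-at-double s (x * m)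
  count-shift s x (suc n) rewrite periodic-* x n | count-shift s x n with does (b n ≟ s)
  ... | true  = refl
  ... | false = refl

  -- Each node halves the shift; with one factor 2 per node, every node of the path still sees a
  -- multiple of its period `double m`.
  pass-periodic : ∀ ss n → pass ss (n + 2 ^ length ss * m) ≡ pass ss n
  pass-periodic []       n = refl
  pass-periodic (s ∷ ss) n
    rewrite trans (*-assoc 2 (2 ^ length ss) m) (sym (double≡2* (2 ^ length ss * m)))
          | periodic-* (2 ^ length ss) n
          | count-shift s (2 ^ length ss) n
          | pass-periodic ss (count (at s) n) = refl

  -- Unboundedness rules out paths that block everything. The class is taken from `c` onwards;
  -- `avoidable-+` and `avoidable-∸` move this starting point.
  Avoidable : ℕ → Set
  Avoidable c = ∃[ ss ] (Unbounded (pass ss) × (∀ q → pass ss (c + q * m) ≡ false))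

  avoidable-+ : ∀ c x → Avoidable c → Avoidable (c + x * m)
  avoidable-+ c x (ss , u , avoids) = ss , u , λ q →
    trans (cong (pass ss) (regroup c x q m)) (avoids (x + q))
    where
    regroup : ∀ c x q m → c + x * m + q * m ≡ c + (x + q) * m
    regroup = solve-∀

  -- The period of a path from `pass-periodic` is a positive multiple of `m`, so an early time of
  -- the class can be moved past the point from which avoidance is known.
  avoidable-∸ : ∀ c x → Avoidable (c + x * m) → Avoidable c
  avoidable-∸ c zero    = subst Avoidable (+-identityʳ c)
  avoidable-∸ c (suc x) a = back (avoidable-∸ (c + m) x (subst Avoidable (sym (+-assoc c m (x * m))) a))
    where
    regroup : ∀ c q y m → c + q * m + suc y * m ≡ c + m + (q + y) * m
    regroup = solve-∀
    back : Avoidable (c + m) → Avoidable c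
    back (ss , u , avoids) with 2 ^ length ss in eq | m^n>0 2 (length ss)
    ... | suc y | _ = ss , u , λ q →
      trans (sym (pass-periodic ss (c + q * m)))
      (trans (cong (λ e → pass ss (c + q * m + e * m)) eq)
      (trans (cong (pass ss) (regroup c q y m)) (avoids (q + y))))

  -- As `double m` is a period, `b` is constant on the whole class, and a single node asking for the
  -- other state blocks it.
  avoidable-stationary : ∀ {c} → b (c + m) ≡ b c → Avoidable c
  avoidable-stationary {c} eq =
    [ not (b c) ] ,
    ▷-unbounded (at (not (b c))) (λ _ → true) (at-unbounded (not (b c)))
      (λ k → k , refl , count-const-true k) ,
    λ q → trans (∧-identityʳ _) (dec-false (b (c + q * m) ≟ not (b c)) (not-¬ (constant q)))
    where
    regroup : ∀ c q m → c + (m + (m + q * m)) ≡ c + q * m + (m + m)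
    regroup = solve-∀
    constant : ∀ q → b (c + q * m) ≡ b c
    constant zero          = cong b (+-identityʳ c)
    constant (suc zero)    = trans (cong (λ x → b (c + x)) (+-identityʳ m)) eq
    constant (suc (suc q)) =
      trans (cong b (trans (regroup c q m)
                           (cong (λ x → c + q * m + x)
                             (trans (cong (m +_) (sym (+-identityʳ m))) (sym (double≡2* m))))))
            (trans (periodic (c + q * m)) (constant q))

  -- If b separates c from c + m, then the child on the side of c is only visited at the even
  -- multiples c + 2pm, and there for the (⌊ c /2⌋ + p m + 1)-st time.
  avoidable-half : ∀ {c} → Avoidable ⌊ c /2⌋ → Avoidable c
  avoidable-half {c} (ss , u , avoids) with b (c + m) ≟ b c
  ... | yes eq = avoidable-stationary eq
  ... | no neq =
    b c ∷ ss , ▷-unbounded (at (b c)) (pass ss) (at-unbounded (b c)) u , λ q → blocked q (parity q)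
    where
    even-time : ∀ p → c + double p * m ≡ c + double (p * m)
    even-time p = cong (c +_)
      (trans (cong (_* m) (double≡2* p)) (trans (*-assoc 2 p m) (sym (double≡2* (p * m)))))
    odd-time : ∀ p → c + suc (double p) * m ≡ c + m + double (p * m)
    odd-time p = trans (regroup c (double p) m) (trans (cong (_+ m) (even-time p)) (swap c (double (p * m)) m))
      where
      regroup : ∀ c x m → c + suc x * m ≡ c + x * m + m
      regroup = solve-∀
      swap : ∀ c x m → c + x + m ≡ c + m + x
      swap = solve-∀
    blocked : ∀ q → Parity q → pass (b c ∷ ss) (c + q * m) ≡ false
    blocked .(double p) (even p) rewrite even-time p | count-shift (b c) p c | count-at-self c | avoids p =
      ∧-zeroʳ _
    blocked .(suc (double p)) (odd p) rewrite odd-time p | periodic-* p (c + m)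
      | dec-false (b (c + m) ≟ b c) neq = refl

  -- These are the descendants of `t` at depth `T`, and each inherits avoidability from its half.
  -- The leading binary digit of `i` chooses the first child of `t`.
  avoidable-descendant : ∀ T t → Avoidable t → ∀ i → i < 2 ^ T → Avoidable (i + t * 2 ^ T)
  avoidable-descendant zero    t a zero    _ = subst Avoidable (sym (*-identityʳ t)) a
  avoidable-descendant zero    t a (suc i) (s≤s ())
  avoidable-descendant (suc T) t a i i< with <-≤-connex i (2 ^ T)
  ... | inj₁ i<2^T =
    subst Avoidable (trans (cong (λ x → i + x * 2 ^ T) (double≡2* t)) (regroup i t (2 ^ T)))
      (avoidable-descendant T (double t)
        (avoidable-half (subst Avoidable (sym (⌊double/2⌋ t)) a)) i i<2^T)
    where
    regroup : ∀ i t e → i + (2 * t) * e ≡ i + t * (2 * e)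
    regroup = solve-∀
  ... | inj₂ 2^T≤i =
    subst Avoidable (trans (cong (λ x → i ∸ 2 ^ T + suc x * 2 ^ T) (double≡2* t))
                    (trans (regroup (i ∸ 2 ^ T) t (2 ^ T)) (cong (_+ t * 2 ^ suc T) (m∸n+n≡m 2^T≤i))))
      (avoidable-descendant T (suc (double t))
        (avoidable-half (subst Avoidable (sym (⌊suc-double/2⌋ t)) a)) (i ∸ 2 ^ T)
        (+-cancelʳ-< (2 ^ T) _ _ (subst (_< 2 ^ T + 2 ^ T) (sym (m∸n+n≡m 2^T≤i))
          (subst (λ x → i < 2 ^ T + x) (+-identityʳ (2 ^ T)) i<))))
    where
    regroup : ∀ i t e → i + suc (2 * t) * e ≡ i + e + t * (2 * e)
    regroup = solve-∀

  -- The descendants of t at depth m fill an interval of length 2 ^ m ≥ m, hence meet every class.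
  avoidable-all : .{{_ : NonZero m}} → ∀ {t} → Avoidable t → ∀ j → Avoidable j
  avoidable-all {t} a j =
    avoidable-∸ j y (subst Avoidable total (avoidable-+ (i + y) q
      (avoidable-descendant m t a i (<-trans (m%n<n z m) (n<2^n m)))))
    where
    y z i q : ℕ
    -- Wanted is `i` below `m` with `i + y` congruent to `j`. Modulo `m`, `y * pred m` stands for
    -- minus `y`.
    y = t * 2 ^ m
    z = j + y * pred m
    i = z % m
    q = z / m
    regroup : ∀ i y x → i + y + x ≡ i + x + y
    regroup = solve-∀
    expand : ∀ j y p → j + y * p + y ≡ j + y * suc p
    expand = solve-∀
    total : i + y + q * m ≡ j + y * m
    total = trans (regroup i y (q * m)) (trans (cong (_+ y) (sym (m≡m%n+[m/n]*n z m)))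
            (trans (expand j y (pred m)) (cong (λ x → j + y * x) (suc-pred m))))

-- Numbering the inner nodes of a tree.

-- Leaves get no position: in the network they are merged into the targets and the source.
data Pos {O : Set} : Tree O → Set where
  here  : ∀ {ts} → Pos (node ts)
  child : ∀ {ts} s → Pos (ts s) → Pos (node ts)

child-injective : ∀ {O} {ts : Bool → Tree O} {s} {p q : Pos (ts s)} →
  child {ts = ts} s p ≡ child s q → p ≡ q
child-injective refl = refl

size : ∀ {O} → Tree O → ℕ
size (leaf _)  = 0
size (node ts) = suc (size (ts true) + size (ts false))

index : ∀ {O} {t : Tree O} → Pos t → Fin (size t)
index                 here            = zero
index {t = node ts} (child true p)  = suc (index p ↑ˡ size (ts false))
index {t = node ts} (child false p) = suc (size (ts true) ↑ʳ index p)

position : ∀ {O} (t : Tree O) → Fin (size t) → Pos t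
position (node ts) zero    = here
position (node ts) (suc i) =
  [ child true ∘ position (ts true) , child false ∘ position (ts false) ]′ (splitAt (size (ts true)) i)

position-index : ∀ {O} {t : Tree O} (p : Pos t) → position t (index p) ≡ p
position-index here = refl
position-index {t = node ts} (child true p)
  rewrite splitAt-↑ˡ (size (ts true)) (index p) (size (ts false)) = cong (child true) (position-index p)
position-index {t = node ts} (child false p)
  rewrite splitAt-↑ʳ (size (ts true)) (size (ts false)) (index p) = cong (child false) (position-index p)

index-position : ∀ {O} (t : Tree O) (i : Fin (size t)) → index (position t i) ≡ i
index-position (node ts) zero    = refl
index-position (node ts) (suc i) with splitAt (size (ts true)) i in eq
... | inj₁ j = cong suc (trans (cong (_↑ˡ _) (index-position (ts true) j)) (splitAt⁻¹-↑ˡ eq))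
... | inj₂ j = cong suc (trans (cong (_ ↑ʳ_) (index-position (ts false) j)) (splitAt⁻¹-↑ʳ eq))

-- The rotor-router network of a tree.

module TreeNetwork
  (r : ℕ → ℕ) (twoState : ∀ n → r n ≡ 1 ⊎ r n ≡ 2) (rotorType : IsRotorType r)
  {B : ℕ} (ts : Bool → Tree (Fin B)) where

  b : ℕ → Bool
  b n = does (r n ℕ.≟ 1)

  open Traversal b

  t : Tree (Fin B)
  t = node ts

  -- The targets take the first `B` vertex numbers, so that `toℕ` reads off the state a target
  -- stands for.
  N V E : ℕ
  N = size t
  V = B + N
  E = N * 2

  target : Fin B → Fin V
  target o = o ↑ˡ N

  vertex : Pos t → Fin V
  vertex p = B ↑ʳ index p

  source : Fin V
  source = vertex here

  vertex-injective : ∀ {p q} → vertex p ≡ vertex q → p ≡ q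
  vertex-injective {p} {q} eq =
    trans (sym (position-index p)) (trans (cong (position t) (↑ʳ-injective B _ _ eq)) (position-index q))

  exit : Maybe (Fin B) → Fin V
  exit = maybe target source

  -- `ι` records where the subtree `a` sits in the whole tree, which permits recursion on `a`.
  enter : ∀ a → (Pos a → Fin V) → Fin V
  enter (leaf o) ι = exit o
  enter (node _) ι = ι here

  next : ∀ a → (Pos a → Fin V) → Pos a → Bool → Fin V
  next (node us) ι here         s = enter (us s) (ι ∘ child s)
  next (node us) ι (child s′ p) s = next (us s′) (ι ∘ child s′) p s

  edge : Pos t → Bool → Fin E
  edge p s = combine (index p) (Inverse.from 2↔Bool s)

  edge-injective : ∀ {p s s′} → edge p s ≡ edge p s′ → s ≡ s′
  edge-injective {p} {s} {s′} eq =
    trans (sym (Inverse.strictlyInverseˡ 2↔Bool s))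
    (trans (cong (Inverse.to 2↔Bool) (combine-injectiveʳ (index p) _ (index p) _ eq))
           (Inverse.strictlyInverseˡ 2↔Bool s′))

  tail tip : Fin N × Fin 2 → Fin V
  tail (i , s) = vertex (position t i)
  tip  (i , s) = next t vertex (position t i) (Inverse.to 2↔Bool s)

  src tgt : Fin E → Fin V
  src e = tail (remQuot 2 e)
  tgt e = tip (remQuot 2 e)

  src-edge : ∀ p s → src (edge p s) ≡ vertex p
  src-edge p s = trans (cong tail (remQuot-combine (index p) (Inverse.from 2↔Bool s)))
                       (cong vertex (position-index p))

  tgt-edge : ∀ p s → tgt (edge p s) ≡ next t vertex p s
  tgt-edge p s = trans (cong tip (remQuot-combine (index p) (Inverse.from 2↔Bool s)))
    (cong₂ (next t vertex) (position-index p) (Inverse.strictlyInverseˡ 2↔Bool s))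

  isTarget : Fin V → Bool
  isTarget v = [ const true , const false ]′ (splitAt B v)

  isTarget-target : ∀ o → isTarget (target o) ≡ true
  isTarget-target o rewrite splitAt-↑ˡ B o N = refl

  isTarget-vertex : ∀ p → isTarget (vertex p) ≡ false
  isTarget-vertex p rewrite splitAt-↑ʳ B N (index p) = refl

  owner : Fin V → Pos t
  -- A target owns no position and gets `here` as a default; the particle never leaves a target by a
  -- rotor.
  owner v = [ const here , position t ]′ (splitAt B v)

  owner-vertex : ∀ p → owner (vertex p) ≡ p
  owner-vertex p rewrite splitAt-↑ʳ B N (index p) = position-index p

  vertex-owner : ∀ v → isTarget v ≡ false → vertex (owner v) ≡ v
  vertex-owner v eq with splitAt B v in split
  vertex-owner v () | inj₁ _
  ... | inj₂ i = trans (cong (B ↑ʳ_) (index-position t i)) (splitAt⁻¹-↑ʳ split)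

  rotor : Fin V → ℕ → Fin E
  rotor v n = edge (owner v) (b n)

  IsSubtree : ∀ a → (Pos a → Pos t) → Set
  IsSubtree a ι = ∀ p s → next t vertex (ι p) s ≡ next a (vertex ∘ ι) p s

  Reach : Fin V → Set
  Reach = Reaches src tgt isTarget

  reach-step : ∀ p s → Reach (next t vertex p s) → Reach (vertex p)
  reach-step p s h =
    subst Reach (src-edge p s) (there (edge p s) (subst Reach (sym (tgt-edge p s)) h))

  -- The route of a traversal down to its leaf is a path in the graph.
  reach-leaf : ∀ a ι → IsSubtree a ι → ∀ n → Reach (exit (leafAt a n)) → Reach (enter a (vertex ∘ ι))
  reach-leaf (leaf o)  ι sub n h = h
  reach-leaf (node us) ι sub n h = reach-step (ι here) (b n)
    (subst Reach (sym (sub here (b n)))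
      (reach-leaf (us (b n)) (ι ∘ child (b n)) (sub ∘ child (b n)) (count (at (b n)) n) h))

  -- The first traversal of the subtree at a node ends at a target or at the source.
  reach-all : Reach source → ∀ a ι → IsSubtree a ι → ∀ p → Reach (vertex (ι p))
  reach-all h (node us) ι sub here        = reach-leaf (node us) ι sub 0 (reach-exit (leafAt (node us) 0))
    where
    reach-exit : ∀ o → Reach (exit o)
    reach-exit (just o) = here (isTarget-target o)
    reach-exit nothing  = h
  reach-all h (node us) ι sub (child s p) = reach-all h (us s) (ι ∘ child s) (sub ∘ child s) p

  module _ (hit : ∃[ n ] ∃[ o ] leafAt t n ≡ just o) where

    reach-source : Reach source
    reach-source = reach-leaf t id (λ _ _ → refl) (proj₁ hit)
      (subst (Reach ∘ exit) (sym (proj₂ (proj₂ hit))) (here (isTarget-target (proj₁ (proj₂ hit)))))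

    network : Network
    network = record
      { V = V ; E = E ; src = src ; tgt = tgt ; source = source
      ; isTarget = isTarget ; rotor = rotor
      ; source-nonTarget = isTarget-vertex here
      ; target-outdeg0 = λ e → isTarget-vertex (position t (proj₁ (remQuot {N} 2 e)))
      ; reach = λ v nt → subst Reach (vertex-owner v nt)
                  (reach-all reach-source t id (λ _ _ → refl) (owner v))
      ; rotor-out = λ v nt n → trans (src-edge (owner v) (b n)) (vertex-owner v nt)
      ; rotor-periodic = λ v _ → proj₁ rotorType , proj₁ (proj₂ rotorType) ,
          λ n → cong (λ x → edge (owner v) (does (x ℕ.≟ 1))) (proj₂ (proj₂ rotorType) n)
      }

    homogeneous : Homogeneous network r
    -- This map only tells 1 from the other states; `twoState` makes that injective on the values of
    -- `r`.
    homogeneous = (λ v x → edge (owner v) (does (x ℕ.≟ 1))) ,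
      λ v _ → (λ i j eq → bits i j (edge-injective {owner v} eq)) , λ _ → refl
      where
      bits : ∀ i j → b i ≡ b j → r i ≡ r j
      bits i j eq with twoState i | twoState j
      ... | inj₁ p | inj₁ q = trans p (sym q)
      ... | inj₂ p | inj₂ q = trans p (sym q)
      ... | inj₁ p | inj₂ q rewrite p | q = contradiction eq λ ()
      ... | inj₂ p | inj₁ q rewrite p | q = contradiction eq λ ()

    open Run network

    -- The number of visits to each node during the first n traversals.
    visits : ∀ (a : Tree (Fin B)) → ℕ → Pos a → ℕ
    visits (node us) n here        = n
    visits (node us) n (child s p) = visits (us s) (count (at s) n) p

    visits-zero : ∀ a p → visits a 0 p ≡ 0
    visits-zero (node us) here        = refl
    visits-zero (node us) (child s p) = visits-zero (us s) p

    output : Maybe (Fin V) → List (Fin V)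
    output = maybe [_] []

    land : Fin V → (Fin V → ℕ) → Config × Maybe (Fin V)
    land w c = if isTarget w then ((source , c) , just w) else ((w , c) , nothing)

    land-target : ∀ o c → land (target o) c ≡ ((source , c) , just (target o))
    land-target o c rewrite isTarget-target o = refl

    land-vertex : ∀ p c → land (vertex p) c ≡ ((vertex p , c) , nothing)
    land-vertex p c rewrite isTarget-vertex p = refl

    bump : Fin V → (Fin V → ℕ) → Fin V → ℕ
    bump v c u = if ⌊ u Fin.≟ v ⌋ then suc (c u) else c u

    bump-self : ∀ v c → bump v c v ≡ suc (c v)
    bump-self v c with v Fin.≟ v
    ... | yes _  = refl
    ... | no v≢v = contradiction refl v≢v

    bump-other : ∀ {u v} c → u ≢ v → bump v c u ≡ c u
    bump-other {u} {v} c neq with u Fin.≟ v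
    ... | yes eq = contradiction eq neq
    ... | no _   = refl

    step-vertex : ∀ p c → step (vertex p , c) ≡ land (next t vertex p (b (c (vertex p)))) (bump (vertex p) c)
    step-vertex p c rewrite owner-vertex p | tgt-edge p (b (c (vertex p))) = refl

    -- `outside` is the frame condition by which a parent keeps track of its own count and of its
    -- other child.
    record Traversed (a : Tree (Fin B)) (ι : Pos a → Pos t) (n T : ℕ) (c : Fin V → ℕ) : Set where
      constructor traversed
      field
        T′      : ℕ
        c′      : Fin V → ℕ
        home    : config T′ ≡ (source , c′)
        hits    : hitsUpTo T′ ≡ hitsUpTo T ++ output (map target (leafAt a n))
        inside  : ∀ p → c′ (vertex (ι p)) ≡ visits a (suc n) p
        outside : ∀ q → (∀ p → q ≢ ι p) → c′ (vertex q) ≡ c (vertex q)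

    traverse-node : ∀ us (ι : Pos (node us) → Pos t) → IsSubtree (node us) ι →
      (∀ {p q} → ι p ≡ ι q → p ≡ q) → ∀ n T c →
      config T ≡ (vertex (ι here) , c) → (∀ p → c (vertex (ι p)) ≡ visits (node us) n p) →
      Traversed (node us) ι n T c
    -- The start is one step before `a` is entered: a leaf has no vertex of its own, so the step
    -- towards it already hits a target or returns to the source.
    traverse : ∀ a (ι : Pos a → Pos t) → IsSubtree a ι →
      (∀ {p q} → ι p ≡ ι q → p ≡ q) → ∀ n T c →
      step (config T) ≡ land (enter a (vertex ∘ ι)) c → (∀ p → c (vertex (ι p)) ≡ visits a n p) →
      Traversed a ι n T c

    traverse (leaf (just o)) ι sub inj n T c eq cs =
      traversed (suc T) c (cong proj₁ eq′) (cong (λ x → hitsUpTo T ++ output (proj₂ x)) eq′) (λ ()) (λ _ _ → refl)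
      where eq′ = trans eq (land-target o c)
    traverse (leaf nothing) ι sub inj n T c eq cs =
      traversed (suc T) c (cong proj₁ eq′) (cong (λ x → hitsUpTo T ++ output (proj₂ x)) eq′) (λ ()) (λ _ _ → refl)
      where eq′ = trans eq (land-vertex here c)
    traverse (node us) ι sub inj n T c eq cs =
      traversed T′ c′ home
        (trans hits (cong (_++ output (map target (leafAt (node us) n)))
          (trans (cong (λ x → hitsUpTo T ++ output (proj₂ x)) eq′) (++-identityʳ (hitsUpTo T)))))
        inside outside
      where
      eq′ = trans eq (land-vertex (ι here) c)
      open Traversed (traverse-node us ι sub inj n (suc T) c (cong proj₁ eq′) cs)

    traverse-node us ι sub inj n T c eq cs =
      traversed T′ c′ home hits inside′ outside′
      where
      v  = vertex (ι here)
      s  = b n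
      c₁ = bump v c
      stepped : step (config T) ≡ land (enter (us s) (vertex ∘ ι ∘ child s)) c₁
      stepped = trans (cong step eq) (trans (step-vertex (ι here) c)
        (cong (λ w → land w c₁) (trans (cong (next t vertex (ι here) ∘ b) (cs here)) (sub here s))))
      away : ∀ s′ p → vertex (ι (child s′ p)) ≢ v
      away s′ p h with inj (vertex-injective h)
      ... | ()
      open Traversed (traverse (us s) (ι ∘ child s) (sub ∘ child s) (child-injective ∘ inj)
        (count (at s) n) T c₁ stepped
        (λ p → trans (bump-other c (away s p)) (cs (child s p))))
      inside′ : ∀ p → c′ (vertex (ι p)) ≡ visits (node us) (suc n) p
      inside′ here = trans (outside (ι here) (λ p h → away s p (cong vertex (sym h))))
        (trans (bump-self v c) (cong suc (cs here)))
      -- Only the clock of the child entered advances.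
      inside′ (child s′ p) with s′ ≟ s
      ... | yes refl = trans (inside p)
                             (cong (λ k → visits (us s) k p) (sym (count-suc-true (at s) (at-self n))))
      ... | no  s′≢s = trans (outside (ι (child s′ p)) (λ q h → disjoint q (inj h)))
        (trans (bump-other c (away s′ p)) (trans (cs (child s′ p))
          (cong (λ k → visits (us s′) k p)
                (sym (count-suc-false (at s′) (dec-false (s ≟ s′) (s′≢s ∘ sym)))))))
        where
        disjoint : ∀ q → child {ts = us} s′ p ≢ child s q
        disjoint q refl = s′≢s refl
      outside′ : ∀ q → (∀ p → q ≢ ι p) → c′ (vertex q) ≡ c (vertex q)
      outside′ q h = trans (outside q (λ p → h (child s p)))
                           (bump-other c (λ e → h here (vertex-injective e)))

    record After (n : ℕ) : Set where
      field
        T      : ℕ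
        c      : Fin V → ℕ
        home   : config T ≡ (source , c)
        counts : ∀ p → c (vertex p) ≡ visits t n p
        total  : length (hitsUpTo T) ≡ count (is-just ∘ leafAt t) n

    traversal : ∀ {n} (A : After n) → Traversed t id n (After.T A) (After.c A)
    traversal A = traverse-node ts id (λ _ _ → refl) id _ T c home counts where open After A

    after : ∀ n → After n
    after zero    = record { T = 0 ; c = λ _ → 0 ; home = refl ; counts = sym ∘ visits-zero t ; total = refl }
    after (suc n) = record
      { T = T′ ; c = c′ ; home = home ; counts = inside
      ; total = trans (cong length hits) (trans (length-++ (hitsUpTo (After.T A)))
                (trans (cong (_+ length (output (map target (leafAt t n)))) (After.total A)) (last (leafAt t n) refl))) }
      where
      A = after n
      open Traversed (traversal A)
      last : ∀ o → leafAt t n ≡ o → count (is-just ∘ leafAt t) n + length (output (map target o))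
                                  ≡ count (is-just ∘ leafAt t) (suc n)
      last o eq rewrite eq with o
      ... | just _  = +-comm _ 1
      ... | nothing = +-comm _ 0

    head-drop-++ : ∀ {A : Set} (xs : List A) x → head (drop (length xs) (xs ++ [ x ])) ≡ just x
    head-drop-++ []       x = refl
    head-drop-++ (_ ∷ xs) x = head-drop-++ xs x

    -- Before traversal `n` there are as many hits as earlier successes, and its own hit is appended
    -- right behind them.
    hit-at : ∀ n {o} → leafAt t n ≡ just o → KthHit (count (is-just ∘ leafAt t) n) (target o)
    hit-at n {o} eq = T′ ,
      trans (cong₂ (λ k xs → head (drop k xs)) (sym (After.total A))
                   (trans hits (cong (λ x → hitsUpTo (After.T A) ++ output (map target x)) eq)))
            (head-drop-++ (hitsUpTo (After.T A)) (target o))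
      where
      A = after n
      open Traversed (traversal A)

-- Periodic sequences and initial parts of periods.

periodic-multiple : ∀ {r : ℕ → ℕ} {p} → Periodic r p → ∀ x n → r (n + x * p) ≡ r n
periodic-multiple {r} {p} per zero    n = cong r (+-identityʳ n)
periodic-multiple {r} {p} per (suc x) n =
  trans (cong r (trans (cong (n +_) (+-comm p (x * p))) (trans (sym (+-assoc n _ p)) (+-comm _ p))))
        (trans (per (n + x * p)) (periodic-multiple {r} per x n))

periodic-% : ∀ {r : ℕ → ℕ} {p} .{{_ : NonZero p}} → Periodic r p → ∀ n → r (n % p) ≡ r n
periodic-% {r} {p} per n =
  trans (sym (periodic-multiple {r} per (n / p) (n % p))) (cong r (sym (m≡m%n+[m/n]*n n p)))

bounded-below : ∀ (r : ℕ → ℕ) p → ∃[ B ] ∀ {n} → n < p → r n < B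
bounded-below r zero    = 0 , λ ()
bounded-below r (suc p) with bounded-below r p
... | B , below = B ⊔ suc (r p) , bound
  where
  bound : ∀ {n} → n < suc p → r n < B ⊔ suc (r p)
  bound {n} n<1+p with m<1+n⇒m<n∨m≡n n<1+p
  ... | inj₁ n<p  = ≤-trans (below n<p) (m≤m⊔n B _)
  ... | inj₂ refl = m≤n⊔m B _

periodic-bounded : ∀ {r : ℕ → ℕ} {p} .{{_ : NonZero p}} → Periodic r p → ∃[ B ] ∀ n → r n < B
periodic-bounded {r} {p} per with bounded-below r p
... | B , below = B , λ n → subst (_< B) (periodic-% {r} per n) (below (m%n<n n p))

module Prefix (D p : ℕ) .{{_ : NonZero D}} .{{_ : NonZero p}} (p≤D : p ≤ D) where

  low : ℕ → Bool
  low i = does (i % D <? p)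

  remainder : ∀ q {a} → a < D → (a + q * D) % D ≡ a
  remainder q a<D = trans ([m+kn]%n≡m%n _ q D) (m<n⇒m%n≡m a<D)

  low-true : ∀ q {a} → a < p → low (a + q * D) ≡ true
  low-true q a<p = dec-true (_ <? p) (subst (_< p) (sym (remainder q (<-≤-trans a<p p≤D))) a<p)

  low-false : ∀ q {a} → p ≤ a → a < D → low (a + q * D) ≡ false
  low-false q p≤a a<D = dec-false (_ <? p) (≤⇒≯ (subst (p ≤_) (sym (remainder q a<D)) p≤a))

  count-low-up-to : ∀ q a → a ≤ p → count low (a + q * D) ≡ a + count low (q * D)
  count-low-up-to q zero    _   = refl
  count-low-up-to q (suc a) a<p =
    trans (count-suc-true low (low-true q a<p)) (cong suc (count-low-up-to q a (<⇒≤ a<p)))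

  count-low-beyond : ∀ q e → p + e ≤ D → count low (e + (p + q * D)) ≡ p + count low (q * D)
  count-low-beyond q zero    _  = count-low-up-to q p ≤-refl
  count-low-beyond q (suc e) le =
    trans (count-suc-false low (trans (cong low (trans (sym (+-assoc e p _)) (cong (_+ q * D) (+-comm e p))))
                                      (low-false q (m≤m+n p e) lt)))
          (count-low-beyond q e (<⇒≤ lt))
    where
    lt : p + e < D
    lt = subst (_≤ D) (+-suc p e) le

  count-low-* : ∀ q → count low (q * D) ≡ q * p
  count-low-* zero    = refl
  count-low-* (suc q) =
    trans (cong (count low) (trans (cong (_+ q * D) (sym (m∸n+n≡m p≤D))) (+-assoc (D ∸ p) p (q * D))))
    (trans (count-low-beyond q (D ∸ p) (≤-reflexive (trans (+-comm p _) (m∸n+n≡m p≤D))))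
           (cong (p +_) (count-low-* q)))

  -- The place of rank `k` among those kept: `k / p` full rounds of length `D`, then `k % p`.
  time : ℕ → ℕ
  time k = k % p + k / p * D

  low-time : ∀ k → low (time k) ≡ true
  low-time k = low-true (k / p) (m%n<n k p)

  time-% : ∀ k → time k % D ≡ k % p
  time-% k = remainder (k / p) (<-≤-trans (m%n<n k p) p≤D)

  count-low-time : ∀ k → count low (time k) ≡ k
  count-low-time k = trans (count-low-up-to (k / p) (k % p) (<⇒≤ (m%n<n k p)))
    (trans (cong (k % p +_) (count-low-* (k / p))) (sym (m≡m%n+[m/n]*n k p)))

-- Rotor types with one swapped block.

module SingleSwap
  (r : ℕ → ℕ) (twoState : ∀ n → r n ≡ 1 ⊎ r n ≡ 2) (blocks : ∀ k → Block12 r k ⊎ Block21 r k)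
  (m j : ℕ) (period : Periodic r (2 * m)) (j<m : j < m) (swapped : Block21 r j)
  (ordered : ∀ k → k < m → k ≢ j → Block12 r k) (3≤m : 3 ≤ m) where

  instance
    m-nonZero : NonZero m
    m-nonZero = >-nonZero (≤-trans (s≤s z≤n) 3≤m)

  b : ℕ → Bool
  b n = does (r n ℕ.≟ 1)

  open Traversal b

  bit : ∀ {n x} → r n ≡ x → b n ≡ does (x ℕ.≟ 1)
  bit = cong (λ x → does (x ℕ.≟ 1))

  alternating : ∀ k → b (suc (double k)) ≡ not (b (double k))
  alternating k rewrite double≡2* k with blocks k
  ... | inj₁ (p , q) rewrite bit p | bit q = refl
  ... | inj₂ (p , q) rewrite bit p | bit q = refl

  open AbBa alternating

  periodic : ∀ n → b (n + double m) ≡ b n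
  periodic n = cong (λ x → does (x ℕ.≟ 1))
    (trans (cong r (trans (+-comm n _) (cong (_+ n) (double≡2* m)))) (period n))

  open Avoidance b alternating m periodic

  ordered-bit : ∀ {k} → k < m → k ≢ j → b (double k) ≡ true
  ordered-bit {k} k<m k≢j = trans (cong b (double≡2* k)) (bit (proj₁ (ordered k k<m k≢j)))

  swapped-bit : b (double j) ≡ false
  swapped-bit = trans (cong b (double≡2* j)) (bit (proj₁ swapped))

  ordered-after : ∀ i → 0 < i → i < m → b (double (j + i)) ≡ true
  ordered-after i 0<i i<m with <-≤-connex (j + i) m
  ... | inj₁ j+i<m = ordered-bit j+i<m (λ eq → <⇒≢ (m<m+n j 0<i) (sym eq))
  ... | inj₂ m≤j+i = trans (cong b (trans (cong double (sym (m∸n+n≡m m≤j+i))) (double-+ l m)))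
                     (trans (periodic (double l)) (ordered-bit (<-trans l<j j<m) (<⇒≢ l<j)))
    where
    l : ℕ
    l = j + i ∸ m
    l<j : l < j
    l<j = +-cancelʳ-< m l j (subst (_< j + m) (sym (m∸n+n≡m m≤j+i)) (+-monoʳ-< j i<m))

  -- For even `m` the shift is by `m / 2` blocks and takes block `j + 1` to another ordered block.
  -- For odd `m` it also changes the place within the block: the first place of the swapped block
  -- goes to the second place of an ordered one, and both hold state 2.
  stationary : ∀ {m} → Parity m → 3 ≤ m → (∀ i → 0 < i → i < m → b (double (j + i)) ≡ true) →
    ∃[ t ] b (t + m) ≡ b t
  stationary (even (suc zero))    (s≤s (s≤s ())) _
  stationary (even (suc (suc h))) _ after =
    double (j + 1) ,
    trans (trans (cong b (trans (sym (double-+ (j + 1) (suc (suc h)))) (cong double (+-assoc j 1 _))))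
                 (after (suc (suc (suc h))) (s≤s z≤n) (s≤s (s≤s (s≤s (s≤s (n≤double h)))))))
          (sym (after 1 (s≤s z≤n) (s≤s (s≤s z≤n))))
  stationary (odd zero)    (s≤s ()) _
  stationary (odd (suc h)) _ after =
    double j ,
    trans (cong b (trans (+-suc (double j) (double (suc h))) (cong suc (sym (double-+ j (suc h))))))
    (trans (alternating (j + suc h))
    (trans (cong not (after (suc h) (s≤s z≤n) (s≤s (s≤s (m≤n⇒m≤1+n (n≤double h))))))
           (sym swapped-bit)))

  avoidable-swap : Avoidable j
  avoidable-swap = avoidable-all (avoidable-stationary (proj₂ (stationary (parity m) 3≤m ordered-after))) j

  module _ (ss : List Bool) (pass-unbounded : Unbounded (pass ss))
    (avoids : ∀ q → pass ss (j + q * m) ≡ false) where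

    -- The time `k` of a child is a block number of its parent, so blocking the class of `j` modulo
    -- `m` leaves only ordered blocks.
    pass⇒ordered : ∀ k → pass ss k ≡ true → b (double k) ≡ true
    pass⇒ordered k passes with k % m ℕ.≟ j
    ... | yes eq = contradiction
            (trans (sym passes) (trans (cong (pass ss) (trans (m≡m%n+[m/n]*n k m) (cong (_+ k / m * m) eq)))
                                       (avoids (k / m))))
            λ ()
    ... | no neq = trans (cong b (trans (cong double (m≡m%n+[m/n]*n k m)) (double-+ (k % m) (k / m * m))))
                   (trans (periodic-* (k / m) (double (k % m))) (ordered-bit (m%n<n k m) neq))

    module _ (r′ : ℕ → ℕ) (p₀ : ℕ) (period′ : Periodic r′ (suc p₀)) where

      p : ℕ
      p = suc p₀

      B D : ℕ
      B = proj₁ (periodic-bounded {r′} period′)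
      -- Depth `p` suffices, since `2 ^ p` exceeds `p`; the surplus leaves are deleted in `word`.
      D = 2 ^ p

      instance
        D-nonZero : NonZero D
        D-nonZero = m^n≢0 2 p

      open Prefix D p (<⇒≤ (n<2^n p))

      -- The target reached for the state x of r′ is the vertex numbered x, so toℕ matches the two.
      label : ℕ → Fin B
      label n = fromℕ< (proj₂ (periodic-bounded {r′} period′) n)

      word : ℕ → Maybe (Fin B)
      word i = if low i then just (label (i % D)) else nothing

      word-periodic : ∀ i → word (D + i) ≡ word i
      word-periodic i = cong (λ x → if does (x <? p) then just (label x) else nothing)
        (trans (cong (_% D) (+-comm D i)) ([m+n]%n≡m%n i D))

      tree : Tree (Fin B)
      tree = counter ss p word

      alive : ℕ → Bool
      alive = live ss p

      leafAt-tree : ∀ n → leafAt tree n ≡ (if alive n then word (count alive n) else nothing)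
      leafAt-tree = leafAt-counter ss pass⇒ordered p word word-periodic

      is-just-leafAt : ∀ n → is-just (leafAt tree n) ≡ (alive ▷ low) n
      is-just-leafAt n rewrite leafAt-tree n with alive n | low (count alive n)
      ... | false | _     = refl
      ... | true  | true  = refl
      ... | true  | false = refl

      -- The hit of rank `k` is the live traversal of rank `time k`.
      hit-tree : ∀ k → ∃[ n ] (leafAt tree n ≡ just (label (k % p)) × count (is-just ∘ leafAt tree) n ≡ k)
      hit-tree k with live-unbounded ss pass-unbounded p (time k)
      ... | n , alive-n , count-n = n ,
        trans (leafAt-tree n) (trans (cong₂ (λ x i → if x then word i else nothing) alive-n count-n)
          (cong₂ (λ x i → if x then just (label i) else nothing) (low-time k) (time-% k))) ,
        trans (count-cong is-just-leafAt n) (trans (count-▷ alive low n)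
          (trans (cong (count low) count-n) (count-low-time k)))

      toℕ-label : ∀ k → toℕ (label (k % p)) ≡ r′ k
      toℕ-label k = trans (toℕ-fromℕ< _) (periodic-% {r′} period′ k)

      models : IsRotorType r → Models r r′
      models rotorType =
        network hit , homogeneous hit , toℕ , (λ _ _ → toℕ-injective) , λ k → target (label (k % p)) ,
          subst (λ i → KthHit i (target (label (k % p)))) (proj₂ (proj₂ (hit-tree k)))
                (hit-at hit (proj₁ (hit-tree k)) (proj₁ (proj₂ (hit-tree k)))) ,
          trans (toℕ-↑ˡ (label (k % p)) N) (toℕ-label k)
        where
        ts : Bool → Tree (Fin B)
        -- With these children `node ts` is `tree` by definition, as `p` is a successor.
        ts s = chain ss (counter ss p₀ (word ∘ branch s))
        open TreeNetwork r twoState rotorType ts hiding (b)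
        hit : ∃[ n ] ∃[ o ] leafAt tree n ≡ just o
        hit = proj₁ (hit-tree 0) , _ , proj₁ (proj₂ (hit-tree 0))
        open Run (network hit)

theorem8p3 : (r : ℕ → ℕ) → IsAbBa r → (m j : ℕ) → FundamentalPeriod r (2 * m)
    → j < m → Block21 r j → (∀ k → k < m → k ≢ j → Block12 r k) → 3 ≤ m
    → Universal r
theorem8p3 r (rotorType , (_ , twoState) , _ , blocks) m j (_ , period , _) j<m swapped ordered 3≤m
           r′ (suc p₀ , _ , period′) =
  models (proj₁ avoidable-swap) (proj₁ (proj₂ avoidable-swap)) (proj₂ (proj₂ avoidable-swap))
    r′ p₀ period′ rotorType
  where open SingleSwap r twoState blocks m j period j<m swapped ordered 3≤m
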